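{- Let $G=(V,E,T,\zeta_v,\zeta_e)$ be a dynamic graph whose time set $T$ is totally ordered by $<_T$, and let $k$ be an integer such that $\operatorname{tw}(G_t)\le k$ for every $t\in T$. Let $\mathcal{G}$ be the Gaifman graph of the treewidth preserving structure $\mathcal{A}(G)$ with linear time relation $R$. Then $\operatorname{tw}(\mathcal{G})\le k+1$.
   Context: A dynamic graph $G=(V,E,T,\zeta_v,\zeta_e)$ consists of a finite vertex set $V$, an edge set $E\subset V\times V$ without loops (simple graphs, directed or undirected), a finite set $T=T(G)$ of times with an order relation $<_T$, and functions $\zeta_v:V\to 2^T$, $\zeta_e:E\to 2^T$ giving the times at which vertices and edges exist. An edge exists only when both its endpoints do: $\zeta_e(uv)\subseteq\zeta_v(u)\cap\zeta_v(v)$. The snapshot $G_t$ is the static graph with vertices $\{v: t\in\zeta_v(v)\}$ and edges $\{uv: t\in\zeta_e(uv)\}$. $\operatorname{tw}$ denotes treewidth (of the underlying undirected graph). Treewidth preserving structure $\mathcal{A}(G)$ with linear time relation: the universe consists of an element $v^t$ for each $v\in V$ and $t\in\zeta_v(v)$, an element for each $t\in T$, and an additional constant $s$. The vocabulary consists of: $V$ (unary, true of all elements $v^t$); for each $v\in V$ a unary relation $L_v$ (true of the elements $v^t$ generated from $v$); $\Xi$ (ternary, true of $(u^t,v^t,t)$ iff $uv\in E$ and $t\in\zeta_e(uv)$); $T$ (unary, true of the time elements); $R$ (binary, true of $(t_1,t_2)$ with $t_1,t_2\in T$ iff $t_1$ immediately precedes $t_2$ in the total order, and of $(s,t)$ iff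 $t$ is the earliest time element). The Gaifman graph of a structure has the universe as vertex set, with two distinct elements adjacent iff they occur together in some tuple of some relation of the vocabulary.
   Formalization: The integer k is additionally required to be nonnegative; for negative k the claim fails (e.g. one time t, all snapshots empty, k = -1: the Gaifman graph has the edge between s and t, so treewidth 1 > 0). -}

module Defs where

open import Level using (0ℓ)
open import Data.Bool.Base using (Bool; T)
open import Data.Fin.Base using (Fin)
open import Data.Integer.Base using (ℤ; _⊖_) renaming (_≤_ to _≤ℤ_)
open import Data.List.Base using (List; _∷_; _++_; [_]; length; map; allFin)
open import Data.List.Extrema.Nat using (max)
open import Data.List.Membership.Propositional using (_∈_)
open import Data.List.Relation.Unary.Linked using (Linked)
open import Data.List.Relation.Unary.Unique.Propositional using (Unique)
open import Data.Nat.Base using (ℕ; _≤_)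
open import Data.Product.Base using (Σ-syntax; ∃-syntax; _×_; _,_)
open import Data.Sum.Base using (_⊎_)
open import Data.Vec.Base using (Vec; []; _∷_)
import Data.Vec.Membership.Propositional as Vec
open import Function.Base using (_∘_)
open import Function.Bundles using (_↔_; Inverse)
open import Relation.Binary.Core using (Rel)
open import Relation.Binary.Construct.Closure.ReflexiveTransitive using (Star)
open import Relation.Binary.Construct.Closure.Symmetric using (SymClosure; fwd; bwd; symmetric)
open import Relation.Binary.Definitions using (Symmetric)
open import Relation.Binary.PropositionalEquality using (_≡_; _≢_; refl; ≢-sym)
open import Relation.Binary.Structures using (IsStrictPartialOrder)
open import Relation.Nullary.Negation using (¬_)
open import Relation.Unary using (Pred)

Finite : Set → Set
Finite A = ∃[ n ] (A ↔ Fin n)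

record Digraph : Set₁ where
  field
    Vertex   : Set
    Edge     : Rel Vertex 0ℓ
    loopless : ∀ v → ¬ Edge v v

record Graph : Set₁ where
  field
    Vertex     : Set
    Adj        : Rel Vertex 0ℓ
    adj-sym    : Symmetric Adj
    adj-irrefl : ∀ v → ¬ Adj v v

underlying : Digraph → Graph
underlying D = record
  { Vertex     = Vertex
  ; Adj        = SymClosure Edge
  ; adj-sym    = symmetric Edge
  ; adj-irrefl = λ { v (fwd e) → loopless v e ; v (bwd e) → loopless v e }
  }
  where open Digraph D

module _ (G : Graph) where
  open Graph G

  Connected : Set
  Connected = ∀ u v → Star Adj u v

  -- Any two vertices satisfying P are joined by a walk inside P.  The empty
  -- set counts as connected.
  ConnectedOn : Pred Vertex 0ℓ → Set
  ConnectedOn P = ∀ {u v} → P u → P v → Star (λ a b → P a × P b × Adj a b) u v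

  -- The closed walk x, xs, x visits at least three vertices, none repeated
  -- except for the return to x.
  IsCycle : Vertex → List Vertex → Set
  IsCycle x xs = 2 ≤ length xs × Unique (x ∷ xs) × Linked Adj (x ∷ xs ++ [ x ])

  Acyclic : Set
  Acyclic = ∀ x xs → ¬ IsCycle x xs

record Tree : Set₁ where
  field
    graph     : Graph
  open Graph graph public renaming (Vertex to Node)
  field
    finite    : Finite Node
    inhabited : Node
    connected : Connected graph
    acyclic   : Acyclic graph

  nodes : List Node
  nodes = let (n , f) = finite in map (Inverse.from f) (allFin n)

-- A bag is a finite vertex set, given as a list without repetitions, so that
-- its cardinality is the length of the list.
record TreeDecomposition (G : Graph) : Set₁ where
  open Graph G
  field
    tree : Tree
  open Tree tree using (Node; nodes)
  field
    bag            : Node → List Vertex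
    bag-unique     : ∀ i → Unique (bag i)
    covers-vertex  : ∀ v → ∃[ i ] v ∈ bag i
    covers-edge    : ∀ {u v} → Adj u v → ∃[ i ] (u ∈ bag i × v ∈ bag i)
    bags-connected : ∀ v → ConnectedOn (Tree.graph tree) (λ i → v ∈ bag i)

  -- The largest bag size minus one; it is -1 if all bags are empty.
  width : ℤ
  width = max 0 (map (length ∘ bag) nodes) ⊖ 1

-- Treewidth is the minimum width of a tree decomposition, so it is at most k
-- iff some decomposition has width at most k.
tw[_]≤_ : Graph → ℤ → Set₁
tw[ G ]≤ k = Σ[ 𝒟 ∈ TreeDecomposition G ] TreeDecomposition.width 𝒟 ≤ℤ k

-- Subsets (of V × V and of Time) are Boolean-valued functions.  Undirected
-- dynamic graphs are those for which E and ζₑ are symmetric.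
record DynamicGraph : Set₁ where
  infix 4 _<_
  field
    V            : Set
    V-finite     : Finite V
    E            : V → V → Bool
    E-loopless   : ∀ v → ¬ T (E v v)
    Time         : Set
    Time-finite  : Finite Time
    _<_          : Rel Time 0ℓ
    <-isStrictPartialOrder : IsStrictPartialOrder _≡_ _<_
    ζᵥ           : V → Time → Bool
    ζₑ           : ∀ {u v} → T (E u v) → Time → Bool
    ζₑ⊆ζᵥ        : ∀ {u v} (e : T (E u v)) t → T (ζₑ e t) → T (ζᵥ u t) × T (ζᵥ v t)

  snapshot : Time → Digraph
  snapshot t = record
    { Vertex   = Σ[ v ∈ V ] T (ζᵥ v t)
    ; Edge     = λ (u , _) (v , _) → Σ[ e ∈ T (E u v) ] T (ζₑ e t)
    ; loopless = λ (v , _) (e , _) → E-loopless v e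
    }

  ImmediatelyPrecedes : Rel Time 0ℓ
  ImmediatelyPrecedes t₁ t₂ = t₁ < t₂ × (∀ t → ¬ (t₁ < t × t < t₂))

  Earliest : Pred Time 0ℓ
  Earliest t = ∀ t′ → t ≡ t′ ⊎ t < t′

record Vocabulary : Set₁ where
  field
    Symbol : Set
    arity  : Symbol → ℕ

record Structure (τ : Vocabulary) : Set₁ where
  open Vocabulary τ
  field
    Universe : Set
    Holds    : (r : Symbol) → Vec Universe (arity r) → Set

gaifman : ∀ {τ} → Structure τ → Graph
gaifman {τ} 𝒮 = record
  { Vertex     = Universe
  ; Adj        = λ x y → x ≢ y ×
                   ∃[ r ] Σ[ xs ∈ Vec Universe (arity r) ]
                     (Holds r xs × x Vec.∈ xs × y Vec.∈ xs)
  ; adj-sym    = λ (x≢y , r , xs , h , x∈xs , y∈xs) →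
                   ≢-sym x≢y , r , xs , h , y∈xs , x∈xs
  ; adj-irrefl = λ _ (x≢x , _) → x≢x refl
  }
  where
  open Vocabulary τ
  open Structure 𝒮

module _ (G : DynamicGraph) where
  open DynamicGraph G

  data 𝒜-Symbol : Set where
    `V : 𝒜-Symbol
    `L : V → 𝒜-Symbol
    `Ξ : 𝒜-Symbol
    `T : 𝒜-Symbol
    `R : 𝒜-Symbol

  𝒜-arity : 𝒜-Symbol → ℕ
  𝒜-arity `V     = 1
  𝒜-arity (`L _) = 1
  𝒜-arity `Ξ     = 3
  𝒜-arity `T     = 1
  𝒜-arity `R     = 2

  𝒜-vocabulary : Vocabulary
  𝒜-vocabulary = record { Symbol = 𝒜-Symbol ; arity = 𝒜-arity }

  data 𝒜-Universe : Set where
    vertexAt : (v : V) (t : Time) → T (ζᵥ v t) → 𝒜-Universe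
    time     : Time → 𝒜-Universe
    s        : 𝒜-Universe

  data 𝒜-Holds : (r : 𝒜-Symbol) → Vec 𝒜-Universe (𝒜-arity r) → Set where
    V-holds  : ∀ {v t p} → 𝒜-Holds `V (vertexAt v t p ∷ [])
    L-holds  : ∀ {v t p} → 𝒜-Holds (`L v) (vertexAt v t p ∷ [])
    Ξ-holds  : ∀ {u v t p q} (e : T (E u v)) → T (ζₑ e t) →
               𝒜-Holds `Ξ (vertexAt u t p ∷ vertexAt v t q ∷ time t ∷ [])
    T-holds  : ∀ {t} → 𝒜-Holds `T (time t ∷ [])
    R-next   : ∀ {t₁ t₂} → ImmediatelyPrecedes t₁ t₂ →
               𝒜-Holds `R (time t₁ ∷ time t₂ ∷ [])
    R-first  : ∀ {t} → Earliest t → 𝒜-Holds `R (s ∷ time t ∷ [])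

  𝒜 : Structure 𝒜-vocabulary
  𝒜 = record { Universe = 𝒜-Universe ; Holds = 𝒜-Holds }

{-# OPTIONS --safe #-}

-- Cone every bag of a tree decomposition of the snapshot at t by the time
-- element t: bags grow by one and all contain t.  Lay the times out in
-- increasing order as a spine of bags {s, t₁}, {t₁, t₂}, …, {tₙ}, and hang the
-- coned decomposition for tᵢ off the spine bag {tᵢ₋₁, tᵢ}.  Spine bags have
-- at most 2 ≤ k + 2 elements, and the bags meeting tᵢ are its coned tree and
-- two adjacent spine bags, so they form a subtree.
module Submission where

open import Defs
open import Data.Bool.Base using (T)
open import Data.Empty using (⊥; ⊥-elim)
open import Data.Fin.Properties using (+↔⊎; 1↔⊤)
open import Data.Integer.Base using (ℤ; 0ℤ; 1ℤ; _+_; _≤_; +_; +≤+; _⊖_)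
import Data.Integer.Properties as ℤ
open import Data.List.Base using (List; []; _∷_; _++_; [_]; length; map; allFin)
open import Data.List.Extrema.Nat using (xs≤max; max≤v⁺)
open import Data.List.Membership.Propositional using (_∈_)
open import Data.List.Membership.Propositional.Properties
  using (∈-map⁺; ∈-map⁻; ∈-++⁻; ∈-allFin)
open import Data.List.Properties using (length-map; map-++)
open import Data.List.Relation.Binary.Permutation.Propositional using (↭-sym; ↭⇒↭ₛ)
open import Data.List.Relation.Binary.Permutation.Propositional.Properties using (∈-resp-↭)
import Data.List.Relation.Binary.Permutation.Setoid.Properties as Permutation
open import Data.List.Relation.Unary.All as All using (All; []; _∷_)
import Data.List.Relation.Unary.All.Properties as All
open import Data.List.Relation.Unary.AllPairs as AllPairs using (AllPairs; []; _∷_)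
open import Data.List.Relation.Unary.Any using (Any; here; there)
open import Data.List.Relation.Unary.Linked as Linked using (Linked; _∷_)
import Data.List.Relation.Unary.Linked.Properties as Linked
open import Data.List.Relation.Unary.Unique.Propositional using (Unique)
import Data.List.Relation.Unary.Unique.Propositional.Properties as Unique
import Data.List.Sort as Sort
open import Data.Nat.Base as ℕ using (ℕ; suc; z≤n; s≤s)
import Data.Nat.Properties as ℕ
open import Data.Product.Base using (Σ-syntax; ∃-syntax; _×_; _,_; proj₁; proj₂)
open import Data.Sum.Base as Sum using (_⊎_; inj₁; inj₂; [_,_]′; swap)
open import Data.Sum.Function.Propositional using (_⊎-↔_)
open import Data.Sum.Properties using (swap-involutive)
open import Data.Unit.Base using (⊤; tt)
open import Data.Vec.Relation.Unary.All as VecAll using ([]; _∷_)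
open import Data.Vec.Base using (Vec)
open import Function.Base using (id; _∘_)
open import Function.Bundles using (Inverse; Injection)
open import Function.Construct.Composition using (_↔-∘_)
open import Function.Construct.Symmetry using (↔-sym)
open import Function.Properties.Inverse using (↔⇒↣)
open import Relation.Binary.Construct.Closure.ReflexiveTransitive
  using (Star; ε; _◅_; _◅◅_; gmap)
open import Relation.Binary.Construct.Closure.Symmetric using (fwd)
import Relation.Binary.Construct.StrictToNonStrict as StrictToNonStrict
open import Level using (0ℓ)
open import Relation.Binary.Core using (Rel)
open import Relation.Binary.Bundles using (DecTotalOrder)
open import Relation.Binary.PropositionalEquality
  using (_≡_; _≢_; refl; sym; trans; cong; subst; setoid)
open import Relation.Binary.Structures using (IsStrictTotalOrder)
open import Relation.Nullary.Negation using (¬_; contradiction)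

-- Trees joined by a bridge.

IsCycle-map : ∀ {G H : Graph} (f : Graph.Vertex G → Graph.Vertex H) →
              (∀ {u v} → f u ≡ f v → u ≡ v) →
              (∀ {u v} → Graph.Adj G u v → Graph.Adj H (f u) (f v)) →
              ∀ {x xs} → IsCycle G x xs → IsCycle H (f x) (map f xs)
IsCycle-map f injective hom {x} {xs} (long , unique , walk) =
  subst (2 ℕ.≤_) (sym (length-map f xs)) long ,
  Unique.map⁺ injective unique ,
  subst (λ ys → Linked _ (f x ∷ ys)) (map-++ f xs [ x ])
    (Linked.map⁺ (Linked.map hom walk))

IsCycle-map⁻ : ∀ {G H : Graph} (f : Graph.Vertex G → Graph.Vertex H) →
               (∀ {u v} → Graph.Adj H (f u) (f v) → Graph.Adj G u v) →
               ∀ {x xs} → IsCycle H (f x) (map f xs) → IsCycle G x xs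
IsCycle-map⁻ f hom⁻ {x} {xs} (long , unique , walk) =
  subst (2 ℕ.≤_) (length-map f xs) long ,
  Unique.map⁻ unique ,
  Linked.map hom⁻ (Linked.map⁻
    (subst (λ ys → Linked _ (f x ∷ ys)) (sym (map-++ f xs [ x ])) walk))

-- An indexed family, so that matching on an edge between the two sides identifies its endpoints
-- with `a` and `b`.
data BridgeAdj (G H : Graph) (a : Graph.Vertex G) (b : Graph.Vertex H) :
               Rel (Graph.Vertex G ⊎ Graph.Vertex H) 0ℓ where
  left  : ∀ {u v} → Graph.Adj G u v → BridgeAdj G H a b (inj₁ u) (inj₁ v)
  right : ∀ {u v} → Graph.Adj H u v → BridgeAdj G H a b (inj₂ u) (inj₂ v)
  cross : BridgeAdj G H a b (inj₁ a) (inj₂ b)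
  back  : BridgeAdj G H a b (inj₂ b) (inj₁ a)

bridge : (G H : Graph) → Graph.Vertex G → Graph.Vertex H → Graph
bridge G H a b = record
  { Vertex     = Graph.Vertex G ⊎ Graph.Vertex H
  ; Adj        = BridgeAdj G H a b
  ; adj-sym    = λ { (left e) → left (Graph.adj-sym G e)
                   ; (right e) → right (Graph.adj-sym H e)
                   ; cross → back
                   ; back → cross }
  ; adj-irrefl = λ { _ (left e) → Graph.adj-irrefl G _ e
                   ; _ (right e) → Graph.adj-irrefl H _ e }
  }

swap-injective : ∀ {A B : Set} {x y : A ⊎ B} → swap x ≡ swap y → x ≡ y
swap-injective {x = x} {y} eq =
  trans (sym (swap-involutive x)) (trans (cong swap eq) (swap-involutive y))

-- This symmetry reduces cycles based at a vertex of `H` to cycles based on the left.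
bridge-swap : ∀ {G H a b x y} →
              BridgeAdj G H a b x y → BridgeAdj H G b a (swap x) (swap y)
bridge-swap (left e)  = right e
bridge-swap (right e) = left e
bridge-swap cross     = back
bridge-swap back      = cross

module _ {G H : Graph} {a : Graph.Vertex G} {b : Graph.Vertex H} where

  -- The first step to the left side can only be `back`, which lands on `a`.
  return-enters-a : ∀ {v z} ws →
    Linked (BridgeAdj G H a b) (inj₂ v ∷ ws ++ [ inj₁ z ]) →
    inj₁ a ∈ ws ++ [ inj₁ z ]
  return-enters-a []            (back ∷ _)       = here refl
  return-enters-a (inj₁ _ ∷ ws) (back ∷ _)       = here refl
  return-enters-a (inj₂ _ ∷ ws) (right _ ∷ walk) = there (return-enters-a ws walk)

  -- The same first step `back` starts from `b`.
  return-leaves-b : ∀ {v z} ws →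
    Linked (BridgeAdj G H a b) (inj₂ v ∷ ws ++ [ inj₁ z ]) →
    inj₂ b ∈ inj₂ v ∷ ws
  return-leaves-b []            (back ∷ _)       = here refl
  return-leaves-b (inj₁ _ ∷ ws) (back ∷ _)       = here refl
  return-leaves-b (inj₂ _ ∷ ws) (right _ ∷ walk) = there (return-leaves-b ws walk)

  -- A walk that leaves the left side does so at `a` and comes back through `a`. All vertices but
  -- the last are distinct, so the second visit is the endpoint `z`.
  stays-left⊎ends-at-a : ∀ {u z} ws →
    Linked (BridgeAdj G H a b) (inj₁ u ∷ ws ++ [ inj₁ z ]) →
    Unique (inj₁ u ∷ ws) →
    (∃[ us ] ws ≡ map inj₁ us) ⊎ (z ≡ a × inj₁ a ∈ inj₁ u ∷ ws)
  stays-left⊎ends-at-a [] _ _ = inj₁ ([] , refl)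
  stays-left⊎ends-at-a (inj₁ y ∷ ws) (_ ∷ walk) (_ ∷ unique)
    with stays-left⊎ends-at-a ws walk unique
  ... | inj₁ (us , refl)  = inj₁ (y ∷ us , refl)
  ... | inj₂ (z≡a , a∈ws) = inj₂ (z≡a , there a∈ws)
  stays-left⊎ends-at-a (inj₂ _ ∷ ws) (cross ∷ walk) ((_ ∷ a∉ws) ∷ _)
    with ∈-++⁻ ws (return-enters-a ws walk)
  ... | inj₁ a∈ws        = contradiction refl (All.lookup a∉ws a∈ws)
  ... | inj₂ (here refl) = inj₂ (refl , here refl)

  -- A closed walk crossing the bridge also crosses it backwards, and so visits a
  -- and b twice each; only for the walk a, b, a is neither visit a repetition.
  bridge-acyclic-left : Acyclic G → ∀ u ws → ¬ IsCycle (bridge G H a b) (inj₁ u) ws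
  bridge-acyclic-left acyclic u (inj₁ y ∷ ws) cycle@(_ , u∉ ∷ unique , left _ ∷ walk)
    with stays-left⊎ends-at-a ws walk unique
  ... | inj₁ (us , refl) = acyclic u (y ∷ us) (IsCycle-map⁻ {G} {bridge G H a b} inj₁ (λ { (left e) → e }) cycle)
  ... | inj₂ (refl , a∈) = contradiction refl (All.lookup u∉ a∈)
  bridge-acyclic-left _ _ (inj₂ _ ∷ []) (s≤s () , _)
  bridge-acyclic-left _ _ (inj₂ _ ∷ inj₁ _ ∷ _) (_ , (_ ∷ a≢a ∷ _) ∷ _ , cross ∷ back ∷ _) =
    a≢a refl
  bridge-acyclic-left _ _ (inj₂ _ ∷ inj₂ _ ∷ ws) (_ , _ ∷ b∉ ∷ _ , cross ∷ right _ ∷ walk) =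
    contradiction refl (All.lookup b∉ (return-leaves-b ws walk))

bridge-acyclic : ∀ {G H a b} → Acyclic G → Acyclic H → Acyclic (bridge G H a b)
bridge-acyclic acyclicG _ (inj₁ u) ws = bridge-acyclic-left acyclicG u ws
bridge-acyclic {G} {H} {a} {b} _ acyclicH (inj₂ u) ws =
  bridge-acyclic-left acyclicH u (map swap ws)
  ∘ IsCycle-map {bridge G H a b} {bridge H G b a} swap swap-injective bridge-swap

bridge-connected : ∀ {G H a b} → Connected G → Connected H → Connected (bridge G H a b)
bridge-connected {a = a} {b} cG cH = λ where
  (inj₁ u) (inj₁ v) → gmap inj₁ left (cG u v)
  (inj₂ u) (inj₂ v) → gmap inj₂ right (cH u v)
  (inj₁ u) (inj₂ v) → gmap inj₁ left (cG u a) ◅◅ cross ◅ gmap inj₂ right (cH b v)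
  (inj₂ u) (inj₁ v) → gmap inj₂ right (cH u b) ◅◅ back ◅ gmap inj₁ left (cG a v)

bridgeTree : (X Y : Tree) → Tree.Node X → Tree.Node Y → Tree
bridgeTree X Y x y = record
  { graph     = bridge X.graph Y.graph x y
  ; finite    = let (m , f) = X.finite ; (n , g) = Y.finite in
                m ℕ.+ n , (↔-sym +↔⊎ ↔-∘ (f ⊎-↔ g))
  ; inhabited = inj₁ x
  ; connected = bridge-connected X.connected Y.connected
  ; acyclic   = bridge-acyclic X.acyclic Y.acyclic
  }
  where
  module X = Tree X
  module Y = Tree Y

singletonTree : Tree
singletonTree = record
  { graph     = record { Vertex = ⊤ ; Adj = λ _ _ → ⊥ ; adj-sym = λ () ; adj-irrefl = λ _ () }
  ; finite    = 1 , ↔-sym 1↔⊤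
  ; inhabited = tt
  ; connected = λ _ _ → ε
  ; acyclic   = λ { _ [] (() , _) ; _ (_ ∷ _) (_ , _ , () ∷ _) }
  }

-- Enumeration of finite sets, and families of bags on a tree.

enumerate : ∀ {A} → Finite A → List A
enumerate (n , f) = map (Inverse.from f) (allFin n)

-- For the nodes of a tree, `enumerate` unfolds to `nodes`, so this also places each node in the
-- list over which the width takes its maximum.
∈-enumerate : ∀ {A} (finite : Finite A) (x : A) → x ∈ enumerate finite
∈-enumerate finite@(_ , f) x = subst (_∈ enumerate finite) (Inverse.strictlyInverseʳ f x)
  (∈-map⁺ (Inverse.from f) (∈-allFin (Inverse.to f x)))

enumerate-unique : ∀ {A} (finite : Finite A) → Unique (enumerate finite)
enumerate-unique (n , f) =
  Unique.map⁺ (Injection.injective (↔⇒↣ (↔-sym f))) (Unique.allFin⁺ n)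

-- A tree decomposition with no graph to cover: pieces over a common universe can be coned and
-- glued, and coverage is established separately. The bound `w` is on bag sizes, hence one more than
-- a bound on the width.
record BagTree (U : Set) (w : ℕ) : Set₁ where
  field
    tree           : Tree
  open Tree tree public using (Node)
  field
    bag            : Node → List U
    bag-unique     : ∀ i → Unique (bag i)
    bag-size       : ∀ i → length (bag i) ℕ.≤ w
    bags-connected : ∀ v → ConnectedOn (Tree.graph tree) (λ i → v ∈ bag i)

toBagTree : ∀ {G n} (𝒟 : TreeDecomposition G) → TreeDecomposition.width 𝒟 ≤ + n →
            BagTree (Graph.Vertex G) (suc n)
toBagTree {n = n} 𝒟 width≤n = record
  { tree           = tree
  ; bag            = bag
  ; bag-unique     = bag-unique
  ; bag-size       = λ i → ℕ.≤-trans
      (All.lookup (xs≤max 0 sizes) (∈-map⁺ (length ∘ bag) (∈-enumerate (Tree.finite tree) i)))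
      (pred≤⇒≤suc _ width≤n)
  ; bags-connected = bags-connected
  }
  where
  open TreeDecomposition 𝒟
  sizes = map (length ∘ bag) (Tree.nodes tree)
  -- If all bags are empty, the width is -1 rather than a truncated 0; hence the separate case `0`.
  pred≤⇒≤suc : ∀ m → m ⊖ 1 ≤ + n → m ℕ.≤ suc n
  pred≤⇒≤suc 0       _         = z≤n
  pred≤⇒≤suc (suc m) (+≤+ m≤n) = s≤s m≤n

width≤ : ∀ {G n} (𝒟 : TreeDecomposition G) →
         (∀ i → length (TreeDecomposition.bag 𝒟 i) ℕ.≤ suc n) →
         TreeDecomposition.width 𝒟 ≤ + n
width≤ 𝒟 small = ℤ.⊖-monoˡ-≤ 1 (max≤v⁺ z≤n (All.map⁺ (All.universal small (Tree.nodes tree))))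
  where open TreeDecomposition 𝒟

singletonBag : ∀ {U w} (xs : List U) → Unique xs → length xs ℕ.≤ w → BagTree U w
singletonBag xs unique small = record
  { tree           = singletonTree
  ; bag            = λ _ → xs
  ; bag-unique     = λ _ → unique
  ; bag-size       = λ _ → small
  ; bags-connected = λ _ _ _ → ε
  }

-- The bags of `u` make up the whole tree, which is connected. By injectivity and freshness, `f x`
-- lies in exactly the bags that contained `x`.
cone : ∀ {A U : Set} {w} (u : U) (f : A → U) →
       (∀ {x y} → f x ≡ f y → x ≡ y) → (∀ x → u ≢ f x) →
       BagTree A w → BagTree U (suc w)
cone {A} {U} u f injective fresh B = record
  { tree           = tree
  ; bag            = bag′
  ; bag-unique     = λ i → All.map⁺ (All.universal fresh _) ∷ Unique.map⁺ injective (bag-unique i)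
  ; bag-size       = λ i → s≤s (subst (ℕ._≤ _) (sym (length-map f (bag i))) (bag-size i))
  ; bags-connected = λ _ → connected′
  }
  where
  open BagTree B
  bag′ : Node → List U
  bag′ i = u ∷ map f (bag i)
  connected′ : ∀ {v} → ConnectedOn (Tree.graph tree) (λ i → v ∈ bag′ i)
  connected′ (here refl) _ =
    gmap id (λ e → here refl , here refl , e) (Tree.connected tree _ _)
  connected′ (there p) q with ∈-map⁻ f p
  connected′ (there p) (here refl) | x , _ , u≡fx = contradiction u≡fx (fresh x)
  connected′ (there p) (there q) | x , x∈ , refl with ∈-map⁻ f q
  ... | y , y∈ , eq with injective eq
  ... | refl = gmap id
    (λ { (a , b , e) → there (∈-map⁺ f a) , there (∈-map⁺ f b) , e })
    (bags-connected x x∈ y∈)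

-- An element with bags on both sides lies in both end bags of the new edge, which therefore joins
-- its two subtrees.
glue : ∀ {U w} (X Y : BagTree U w) (x : BagTree.Node X) (y : BagTree.Node Y) →
       (∀ {v i j} → v ∈ BagTree.bag X i → v ∈ BagTree.bag Y j →
                    v ∈ BagTree.bag X x × v ∈ BagTree.bag Y y) →
       BagTree U w
glue {U} X Y x y agree = record
  { tree           = bridgeTree X.tree Y.tree x y
  ; bag            = bag
  ; bag-unique     = Sum.[_,_] X.bag-unique Y.bag-unique
  ; bag-size       = Sum.[_,_] X.bag-size Y.bag-size
  ; bags-connected = λ v {i} {j} → connected i j
  }
  where
  module X = BagTree X
  module Y = BagTree Y
  G = bridge (Tree.graph X.tree) (Tree.graph Y.tree) x y
  bag : X.Node ⊎ Y.Node → List U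
  bag = [ X.bag , Y.bag ]′
  module _ {v : U} where
    Walk : Rel (X.Node ⊎ Y.Node) _
    Walk = Star (λ i j → v ∈ bag i × v ∈ bag j × Graph.Adj G i j)
    inX : ∀ {i j} → v ∈ X.bag i → v ∈ X.bag j → Walk (inj₁ i) (inj₁ j)
    inX p q = gmap inj₁ (λ { (a , b , e) → a , b , left e }) (X.bags-connected v p q)
    inY : ∀ {i j} → v ∈ Y.bag i → v ∈ Y.bag j → Walk (inj₂ i) (inj₂ j)
    inY p q = gmap inj₂ (λ { (a , b , e) → a , b , right e }) (Y.bags-connected v p q)
    connected : ∀ i j → v ∈ bag i → v ∈ bag j → Walk i j
    connected (inj₁ _) (inj₁ _) p q = inX p q
    connected (inj₂ _) (inj₂ _) p q = inY p q
    connected (inj₁ _) (inj₂ _) p q = let (a , b) = agree p q in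
      inX p a ◅◅ (a , b , cross) ◅ inY b q
    connected (inj₂ _) (inj₁ _) p q = let (a , b) = agree q p in
      inY p b ◅◅ (b , a , back) ◅ inX a q

-- The caterpillar built along a list of times.

data Consecutive {A : Set} (x y : A) : List A → Set where
  here  : ∀ {zs} → Consecutive x y (x ∷ y ∷ zs)
  there : ∀ {z zs} → Consecutive x y zs → Consecutive x y (z ∷ zs)

Consecutive-map : ∀ {A B : Set} (f : A → B) {x y zs} →
                  Consecutive x y zs → Consecutive (f x) (f y) (map f zs)
Consecutive-map f here      = here
Consecutive-map f (there c) = there (Consecutive-map f c)

module _ (G : DynamicGraph) where
  open DynamicGraph G

  data _OccursAt_ : 𝒜-Universe G → Time → Set where
    vertexAt : ∀ {v t p} → vertexAt v t p OccursAt t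
    time     : ∀ {t} → time t OccursAt t

  OccursAt-functional : ∀ {x t t′} → x OccursAt t → x OccursAt t′ → t ≡ t′
  OccursAt-functional vertexAt vertexAt = refl
  OccursAt-functional time     time     = refl

  -- The induction invariant. The element `p` comes just before the first time of `ts`: it is `s` at
  -- the outset and the previous time afterwards. Having `p` in the root bag allows attachment to an
  -- earlier spine bag, and `within` limits what the two sides can share.
  record Caterpillar (w : ℕ) (p : 𝒜-Universe G) (ts : List Time) : Set₁ where
    field
      bags : BagTree (𝒜-Universe G) w
    open BagTree bags public
    field
      root               : Node
      p∈root             : p ∈ bag root
      within             : ∀ {x i} → x ∈ bag i → x ≡ p ⊎ Any (x OccursAt_) ts
      covers-occurrence  : ∀ {x t} → t ∈ ts → x OccursAt t → ∃[ i ] x ∈ bag i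
      covers-edge        : ∀ {t u v} → t ∈ ts → ∀ {p q} (e : T (E u v)) → T (ζₑ e t) →
                           ∃[ i ] (vertexAt u t p ∈ bag i × vertexAt v t q ∈ bag i × time t ∈ bag i)
      covers-consecutive : ∀ {x y} → Consecutive x y (p ∷ map time ts) →
                           ∃[ i ] (x ∈ bag i × y ∈ bag i)

  module _ {n : ℕ} (snapshot-tw : ∀ t → tw[ underlying (snapshot t) ]≤ (+ n)) where

    module Cone (t : Time) where
      module 𝒟 = TreeDecomposition (proj₁ (snapshot-tw t))

      at : Σ[ v ∈ V ] T (ζᵥ v t) → 𝒜-Universe G
      at (v , p) = vertexAt v t p

      bags : BagTree (𝒜-Universe G) (2 ℕ.+ n)
      bags = cone (time t) at (λ { refl → refl }) (λ _ ())
                  (toBagTree (proj₁ (snapshot-tw t)) (proj₂ (snapshot-tw t)))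
      open BagTree bags public

      -- Any node can serve as the point of attachment, since every coned bag contains `time t`.
      root : Node
      root = Tree.inhabited tree

      within : ∀ {x i} → x ∈ bag i → x OccursAt t
      within (here refl) = time
      within (there x∈) with ∈-map⁻ at x∈
      ... | _ , _ , refl = vertexAt

      ∋at : ∀ {i v} → v ∈ 𝒟.bag i → at v ∈ bag i
      ∋at = there ∘ ∈-map⁺ at

    -- Induction on `ts`: the tail, built with `time t` in the role of `p`, hangs off the bag of `p`
    -- and `time t`. As `p` occurs at no time of `ts`, it enters neither the coned snapshot nor the
    -- tail.
    caterpillar : ∀ p ts → All (λ t → ¬ p OccursAt t) ts → Unique ts → Caterpillar (2 ℕ.+ n) p ts
    caterpillar p [] _ _ = record
      -- The end of the spine: the last time alone, or `s` if there are no times.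
      { bags               = singletonBag [ p ] ([] ∷ []) (s≤s z≤n)
      ; root               = tt
      ; p∈root             = here refl
      ; within             = λ { (here eq) → inj₁ eq }
      ; covers-occurrence  = λ ()
      ; covers-edge        = λ ()
      ; covers-consecutive = λ { (there ()) }
      }
    caterpillar p (t ∷ ts) (p∌t ∷ p∌ts) (t∉ts ∷ unique) = record
      { bags               = glue upper tail.bags (inj₁ tt) tail.root λ {_} {i} → agree i
      ; root               = inj₁ (inj₁ tt)
      ; p∈root             = here refl
      ; within             = λ {_} {i} → within i
      ; covers-occurrence  = covers-occurrence
      ; covers-edge        = covers-edge
      ; covers-consecutive = covers-consecutive
      }
      where
      module cone = Cone t
      rest : Caterpillar (2 ℕ.+ n) (time t) ts
      -- The element `time t` occurs only at `t`, which is absent from `ts` by distinctness.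
      rest = caterpillar (time t) ts (All.map (λ { t≢t′ time → t≢t′ refl }) t∉ts) unique
      module tail = Caterpillar rest

      spine : BagTree (𝒜-Universe G) (2 ℕ.+ n)
      spine = singletonBag (p ∷ time t ∷ [])
        (((λ { refl → p∌t time }) ∷ []) ∷ [] ∷ []) (s≤s (s≤s z≤n))

      upper : BagTree (𝒜-Universe G) (2 ℕ.+ n)
      upper = glue spine cone.bags tt cone.root λ where
        (here refl) x∈         → contradiction (cone.within x∈) p∌t
        (there (here refl)) x∈ → there (here refl) , here refl

      upper-within : ∀ i {x} → x ∈ BagTree.bag upper i → x ≡ p ⊎ x OccursAt t
      upper-within (inj₁ _) (here eq)           = inj₁ eq
      upper-within (inj₁ _) (there (here refl)) = inj₂ time
      upper-within (inj₂ _) x∈                  = inj₂ (cone.within x∈)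

      -- The tail holds only `time t` and elements occurring at times of `ts`. The hypothesis on `p`
      -- and the distinctness of the times leave `time t` as the only shared element.
      agree : ∀ i {j x} → x ∈ BagTree.bag upper i → x ∈ tail.bag j →
                x ∈ (p ∷ time t ∷ []) × x ∈ tail.bag tail.root
      agree i x∈ x∈′ with tail.within x∈′ | upper-within i x∈
      ... | inj₁ refl | _         = there (here refl) , tail.p∈root
      ... | inj₂ at   | inj₁ refl = ⊥-elim (All.lookupWith (λ p∌t′ → p∌t′) p∌ts at)
      ... | inj₂ at   | inj₂ at-t =
        ⊥-elim (All.lookupWith (λ t≢t′ at′ → t≢t′ (OccursAt-functional at-t at′)) t∉ts at)

      bag = [ BagTree.bag upper , tail.bag ]′

      within : ∀ i {x} → x ∈ bag i → x ≡ p ⊎ Any (x OccursAt_) (t ∷ ts)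
      within (inj₁ i) x∈ = Sum.map id here (upper-within i x∈)
      within (inj₂ _) x∈ with tail.within x∈
      ... | inj₁ refl = inj₂ (here time)
      ... | inj₂ at   = inj₂ (there at)

      covers-occurrence : ∀ {x t′} → t′ ∈ t ∷ ts → x OccursAt t′ → ∃[ i ] x ∈ bag i
      covers-occurrence (here refl) (vertexAt {v} {p = q}) =
        let (i , v∈) = cone.𝒟.covers-vertex (v , q) in inj₁ (inj₂ i) , cone.∋at v∈
      covers-occurrence (here refl) time = inj₁ (inj₁ tt) , there (here refl)
      covers-occurrence (there t′∈) at =
        let (i , x∈) = tail.covers-occurrence t′∈ at in inj₂ i , x∈

      covers-edge : ∀ {t′ u v} → t′ ∈ t ∷ ts → ∀ {q r} (e : T (E u v)) → T (ζₑ e t′) →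
        ∃[ i ] (vertexAt u t′ q ∈ bag i × vertexAt v t′ r ∈ bag i × time t′ ∈ bag i)
      covers-edge (here refl) {q} {r} e e-at =
        -- Snapshot edges disregard the existence proofs of their endpoints, so the given `q` and
        -- `r` may be supplied. The cone puts `time t` into the same bag, which completes the triple
        -- of `Ξ`.
        let (i , u∈ , v∈) = cone.𝒟.covers-edge {_ , q} {_ , r} (fwd (e , e-at)) in
        inj₁ (inj₂ i) , cone.∋at u∈ , cone.∋at v∈ , here refl
      covers-edge (there t′∈) e e-at =
        let (i , members) = tail.covers-edge t′∈ e e-at in inj₂ i , members

      covers-consecutive : ∀ {x y} → Consecutive x y (p ∷ time t ∷ map time ts) →
                           ∃[ i ] (x ∈ bag i × y ∈ bag i)
      covers-consecutive here      = inj₁ (inj₁ tt) , here refl , there (here refl)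
      covers-consecutive (there c) =
        let (i , members) = tail.covers-consecutive c in inj₂ i , members

  -- The sorted list of times and the relation `R`.

  module _ (sto : IsStrictTotalOrder _≡_ _<_) where
    open IsStrictTotalOrder sto using (irrefl; asym)

    -- An entry between the two would violate immediate precedence, and the reverse order would
    -- violate asymmetry.
    immediatelyPrecedes⇒consecutive : ∀ {t₁ t₂ ts} → AllPairs _<_ ts → t₁ ∈ ts → t₂ ∈ ts →
                                      ImmediatelyPrecedes t₁ t₂ → Consecutive t₁ t₂ ts
    immediatelyPrecedes⇒consecutive _ (here refl) (here refl) (t<t , _) =
      contradiction t<t (irrefl refl)
    immediatelyPrecedes⇒consecutive _ (here refl) (there (here refl)) _ = here
    immediatelyPrecedes⇒consecutive ((t₁<t ∷ _) ∷ t<ts ∷ _) (here refl) (there (there t₂∈)) (_ , gap) =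
      contradiction (t₁<t , All.lookup t<ts t₂∈) (gap _)
    immediatelyPrecedes⇒consecutive (t₂<ts ∷ _) (there t₁∈) (here refl) (t₁<t₂ , _) =
      contradiction t₁<t₂ (asym (All.lookup t₂<ts t₁∈))
    immediatelyPrecedes⇒consecutive (_ ∷ sorted) (there t₁∈) (there t₂∈) ip =
      there (immediatelyPrecedes⇒consecutive sorted t₁∈ t₂∈ ip)

    -- The head of an increasing list lies below every other entry, so an earliest time must be the
    -- head.
    earliest⇒consecutive : ∀ {t ts} (x : 𝒜-Universe G) → AllPairs _<_ ts → t ∈ ts → Earliest t →
                           Consecutive x (time t) (x ∷ map time ts)
    earliest⇒consecutive _ _ (here refl) _ = here
    earliest⇒consecutive {ts = t′ ∷ _} _ (t′<ts ∷ _) (there t∈) earliest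
      with earliest t′ | All.lookup t′<ts t∈
    ... | inj₁ refl | t<t  = contradiction t<t (irrefl refl)
    ... | inj₂ t<t′ | t′<t = contradiction t<t′ (asym t′<t)

    sortedTimes : Σ[ ts ∈ List Time ] AllPairs _<_ ts × (∀ t → t ∈ ts)
    sortedTimes =
      sort times ,
      -- Sorting yields only the non-strict order; distinctness, preserved under permutation, makes
      -- it strict.
      AllPairs.zipWith (λ { (inj₁ t<t′ , _) → t<t′ ; (inj₂ t≡t′ , t≢t′) → contradiction t≡t′ t≢t′ })
        ( Linked.Linked⇒AllPairs (DecTotalOrder.trans order) (sort-↗ times)
        , Permutation.Unique-resp-↭ (setoid Time) (↭⇒↭ₛ (↭-sym (sort-↭ times)))
            (enumerate-unique Time-finite)) ,
      λ t → ∈-resp-↭ (↭-sym (sort-↭ times)) (∈-enumerate Time-finite t)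
      where
      order : DecTotalOrder _ _ _
      order = record { isDecTotalOrder = StrictToNonStrict.isDecTotalOrder _≡_ _<_ sto }
      open Sort order
      times = enumerate Time-finite

    -- The tree decomposition of the Gaifman graph.

    module _ {n : ℕ} (snapshot-tw : ∀ t → tw[ underlying (snapshot t) ]≤ (+ n)) where
      private
        ts     = proj₁ sortedTimes
        sorted = proj₁ (proj₂ sortedTimes)
        ∈ts    = proj₂ (proj₂ sortedTimes)
        spine : Caterpillar (2 ℕ.+ n) s ts
        -- The spine may start at `s` because `s` occurs at no time.
        spine = caterpillar snapshot-tw s ts (All.universal (λ _ ()) ts)
          (AllPairs.map (λ { t<t refl → irrefl refl t<t }) sorted)

      open Caterpillar spine

      covers-element : ∀ x → ∃[ i ] x ∈ bag i
      covers-element (vertexAt v t p) = covers-occurrence (∈ts t) vertexAt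
      covers-element (time t)         = covers-occurrence (∈ts t) time
      covers-element s                = root , p∈root

      -- Gaifman edges are pairs of entries of one tuple, so a bag containing the whole tuple covers
      -- all of them, in either direction.
      covers-tuple : ∀ {r} {xs : Vec _ (𝒜-arity G r)} → 𝒜-Holds G r xs →
                     ∃[ i ] VecAll.All (_∈ bag i) xs
      covers-tuple V-holds = let (i , x∈) = covers-element _ in i , x∈ ∷ []
      covers-tuple L-holds = let (i , x∈) = covers-element _ in i , x∈ ∷ []
      covers-tuple T-holds = let (i , x∈) = covers-element _ in i , x∈ ∷ []
      covers-tuple (Ξ-holds {t = t} e e-at) =
        let (i , u∈ , v∈ , t∈) = covers-edge (∈ts t) e e-at in i , u∈ ∷ v∈ ∷ t∈ ∷ []
      covers-tuple (R-next ip) =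
        -- The `there` skips the leading `s` of the spine, which serves `R-first`.
        let (i , x∈ , y∈) = covers-consecutive (there (Consecutive-map time
              (immediatelyPrecedes⇒consecutive sorted (∈ts _) (∈ts _) ip)))
        in i , x∈ ∷ y∈ ∷ []
      covers-tuple (R-first earliest) =
        let (i , x∈ , y∈) = covers-consecutive (earliest⇒consecutive s sorted (∈ts _) earliest)
        in i , x∈ ∷ y∈ ∷ []

      gaifmanDecomposition : TreeDecomposition (gaifman (𝒜 G))
      gaifmanDecomposition = record
        { tree           = tree
        ; bag            = bag
        ; bag-unique     = bag-unique
        ; covers-vertex  = covers-element
        ; covers-edge    = λ (_ , _ , _ , holds , x∈ , y∈) →
            let (i , members) = covers-tuple holds in
            i , VecAll.lookup members x∈ , VecAll.lookup members y∈
        ; bags-connected = bags-connected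
        }

      gaifman-tw : tw[ gaifman (𝒜 G) ]≤ (+ suc n)
      gaifman-tw = gaifmanDecomposition , width≤ gaifmanDecomposition bag-size

theorem6 : (G : DynamicGraph) →
    let open DynamicGraph G in
    IsStrictTotalOrder _≡_ _<_ →
    (k : ℤ) → 0ℤ ≤ k →
    (∀ t → tw[ underlying (snapshot t) ]≤ k) →
    tw[ gaifman (𝒜 G) ]≤ (k + 1ℤ)
-- Nonnegativity of `k` leaves only this case. For `k` equal to -1, all snapshots would be empty,
-- yet the edge from `s` to a first time already forces width 1.
theorem6 G sto (+ n) _ snapshot-tw =
  subst (λ m → tw[ gaifman (𝒜 G) ]≤ (+ m)) (ℕ.+-comm 1 n) (gaifman-tw G sto snapshot-tw)
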